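{- As formal power series in $z$, $$\mathfrak I(q,t,x;z)=\cfrac{1}{1-txz-\cfrac{tq\,z^2}{1-(1+t)q\,z-\cfrac{tq^3z^2}{1-(1+t)q^2z-\cfrac{tq^5z^2}{1-(1+t)q^3z-\cdots}}}},$$ i.e. the Jacobi-type continued fraction with $b_0=tx$, $b_j=(1+t)q^j$ and $\lambda_j=tq^{2j-1}$ for $j\ge1$.
   Context: $\mathrm{Av}_n(321)$ is the set of permutations $\sigma=a_1\ldots a_n$ of $[n]$ with no $i<j<k$ such that $a_i>a_j>a_k$ (for $n=0$, only the empty permutation). $\mathrm{inv}\,\sigma=\#\{(i,j):i<j,\ a_i>a_j\}$; $\mathrm{lrm}\,\sigma$ is the number of $i$ with $a_i=\max\{a_1,\dots,a_i\}$; $\mathrm{fix}\,\sigma=\#\{i:a_i=i\}$. Let $I_n(q,t,x)=\sum_{\sigma\in\mathrm{Av}_n(321)}q^{\mathrm{inv}\,\sigma}t^{\mathrm{lrm}\,\sigma}x^{\mathrm{fix}\,\sigma}$ and $\mathfrak I(q,t,x;z)=\sum_{n\ge0}I_n(q,t,x)z^n$. A Jacobi-type continued fraction $\cfrac{1}{1-b_0z-\cfrac{\lambda_1z^2}{1-b_1z-\cfrac{\lambda_2z^2}{1-b_2z-\cdots}}}$ is understood as the $z$-adic limit of its finite truncations in the ring of formal power series in $z$. -}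

module Defs where

open import Data.Nat using (ℕ; zero; suc; _+_; _*_; _∸_; _≤ᵇ_; _<ᵇ_; _≡ᵇ_; _⊔_)
open import Data.Bool using (Bool; true; false; _∧_; _∨_; not; if_then_else_)
open import Data.List using (List; []; _∷_; map; concatMap; foldr; take)

-- Permutations of [n] as words.  σ = a₁…aₙ is encoded 0-based as a list
-- of naturals: the value j+1 of [n] is stored as j, and position i+1 as
-- index i.  (Shifting all values and positions by 1 changes none of
-- inv, lrm, fix, or 321-containment.)

range : ℕ → List ℕ
range zero    = []
range (suc k) = zero ∷ map suc (range k)

words : ℕ → ℕ → List (List ℕ)
words zero    k = [] ∷ []
words (suc n) k = concatMap (λ a → map (a ∷_) (words n k)) (range k)

anyB : {A : Set} → (A → Bool) → List A → Bool
anyB p []      = false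
anyB p (a ∷ w) = p a ∨ anyB p w

countB : {A : Set} → (A → Bool) → List A → ℕ
countB p []      = 0
countB p (a ∷ w) = (if p a then 1 else 0) + countB p w

distinct : List ℕ → Bool
distinct []      = true
distinct (a ∷ w) = not (anyB (λ b → a ≡ᵇ b) w) ∧ distinct w

-- A word of length n with entries in {0,…,n-1} is a permutation of
-- {0,…,n-1} iff its entries are pairwise distinct.
perms : ℕ → List (List ℕ)
perms n = go (words n n)
  where
  go : List (List ℕ) → List (List ℕ)
  go []      = []
  go (w ∷ ws) = if distinct w then w ∷ go ws else go ws

pat21 : ℕ → List ℕ → Bool
pat21 a []      = false
pat21 a (b ∷ w) = ((b <ᵇ a) ∧ anyB (λ c → c <ᵇ b) w) ∨ pat21 a w

has321 : List ℕ → Bool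
has321 []      = false
has321 (a ∷ w) = pat21 a w ∨ has321 w

inv : List ℕ → ℕ
inv []      = 0
inv (a ∷ w) = countB (λ b → b <ᵇ a) w + inv w

maxList : List ℕ → ℕ
maxList = foldr _⊔_ 0

lrm : List ℕ → ℕ
lrm w = countB (λ i → go i w ≡ᵇ maxList (take (suc i) w)) (range (len w))
  where
  len : List ℕ → ℕ
  len []      = 0
  len (_ ∷ v) = suc (len v)
  go : ℕ → List ℕ → ℕ
  go i       []      = 0
  go zero    (a ∷ v) = a
  go (suc i) (a ∷ v) = go i v

fixFrom : ℕ → List ℕ → ℕ
fixFrom i []      = 0
fixFrom i (a ∷ w) = (if a ≡ᵇ i then 1 else 0) + fixFrom (suc i) w

fix : List ℕ → ℕ
fix = fixFrom 0

-- Polynomials in q, t, x with natural-number coefficients, represented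
-- by their coefficient function:  p a b c = [q^a t^b x^c] p.
-- Equality of polynomials is pointwise equality of coefficients.

Poly : Set
Poly = ℕ → ℕ → ℕ → ℕ

sumTo : ℕ → (ℕ → ℕ) → ℕ
sumTo zero    f = f 0
sumTo (suc n) f = sumTo n f + f (suc n)

0P : Poly
0P _ _ _ = 0

mono : ℕ → ℕ → ℕ → Poly
mono i j k a b c = if (i ≡ᵇ a) ∧ (j ≡ᵇ b) ∧ (k ≡ᵇ c) then 1 else 0

1P : Poly
1P = mono 0 0 0

_+P_ : Poly → Poly → Poly
(p +P r) a b c = p a b c + r a b c

_*P_ : Poly → Poly → Poly
(p *P r) a b c =
  sumTo a λ i → sumTo b λ j → sumTo c λ k →
    p i j k * r (a ∸ i) (b ∸ j) (c ∸ k)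

-- Formal power series in z with coefficients in ℕ[q,t,x]:
-- F n = [z^n] F.

Series : Set
Series = ℕ → Poly

0S : Series
0S _ = 0P

sumPTo : ℕ → (ℕ → Poly) → Poly
sumPTo zero    f = f 0
sumPTo (suc n) f = sumPTo n f +P f (suc n)

-- invZ h = 1 / (1 - z·h), i.e. the unique series f with f = 1 + z·h·f:
--   f₀ = 1,   f_{n+1} = Σ_{k=0}^{n} h_k f_{n-k}.
-- approx h n is correct on indices ≤ n.
approx : Series → ℕ → Series
approx h zero    m = 1P
approx h (suc n) m =
  if m ≤ᵇ n then approx h n m
  else sumPTo n (λ k → h k *P approx h n (n ∸ k))

invZ : Series → Series
invZ h m = approx h m m

bcoef : ℕ → Poly
bcoef zero    = mono 0 1 1
bcoef (suc j) = mono (suc j) 0 0 +P mono (suc j) 1 0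

lam : ℕ → Poly          -- λ_j for j ≥ 1
lam j = mono (2 * j ∸ 1) 1 0

-- tail j m : the truncation of depth m of the continued fraction
--   1/(1 - b_j z - λ_{j+1} z² /(1 - b_{j+1} z - …))
-- i.e. tail j 0 = 0 and
--   tail j (m+1) = 1/(1 - b_j z - λ_{j+1} z² · tail (j+1) m)
--               = 1/(1 - z·(b_j + z·λ_{j+1}·tail (j+1) m)).
tailCF : ℕ → ℕ → Series
tailCF j zero    = 0S
tailCF j (suc m) = invZ h
  where
  h : Series
  h zero    = bcoef j
  h (suc k) = lam (suc j) *P tailCF (suc j) m k

JF : ℕ → Series
JF m = tailCF 0 m

Icoef : ℕ → Poly
Icoef n a b c =
  countB (λ w → not (has321 w) ∧ (inv w ≡ᵇ a) ∧ (lrm w ≡ᵇ b) ∧ (fix w ≡ᵇ c))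
         (perms n)

𝔍 : Series
𝔍 = Icoef

{-# OPTIONS --safe #-}
module Submission where

-- Read a 321-avoiding permutation from left to right: every letter is either a
-- left-to-right maximum or the smallest unused value.  If k unused values lie below
-- the current maximum, then a new maximum leads to some k′ ≥ k and exceeds exactly
-- k′ later letters; it is a fixed point iff k′ = 0.  Any other letter leads from k
-- to k - 1, exceeds no later letter and is not fixed.  So 𝔍 n is a sum W 0 n over
-- Łukasiewicz paths, whereas the continued fraction counts Motzkin paths.  To compare
-- the two, note that the current maximum is i + k - 1, where i is the next position
-- (from 0), and let i + S be the set of left-to-right maxima ≥ i placed so far: summing
-- W k over the subsets S of {0,…,k-1} that have h elements and contain k-1 (k = 0 if
-- h = 0), with weight q to the sum of S, gives the generating function of the
-- Motzkin paths from height h to 0, because both sides satisfy the same recursion in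
-- the length of the paths.

open import Defs
open import Algebra.Bundles using (CommutativeSemiring)
import Algebra.Solver.Ring.NaturalCoefficients.Default as Solver
open import Algebra.Structures.Biased using (isCommutativeMonoidˡ; isCommutativeSemiringˡ)
open import Data.Bool using (Bool; true; false; _∧_; _∨_; not; if_then_else_)
open import Data.Bool.Properties using (∨-zeroʳ; ∨-identityʳ; ∨-comm)
open import Data.List using (List; []; _∷_; map; concatMap; take; length; _++_; _∷ʳ_)
open import Data.List.Properties using (++-identityʳ; ∷ʳ-++; length-++)
open import Data.List.Relation.Unary.All as All using (All; []; _∷_)
import Data.List.Relation.Unary.All.Properties as Allₚ
open import Data.List.Relation.Unary.AllPairs using (AllPairs; []; _∷_)
import Data.List.Relation.Unary.AllPairs.Properties as AllPairsₚ
open import Data.List.Relation.Unary.Unique.Propositional using (Unique)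
import Data.Nat as ℕ
open import Data.Nat using (ℕ; zero; suc; _∸_; _≤_; _<_; z≤n; s≤s; _≡ᵇ_; _≤ᵇ_; _<ᵇ_; _⊔_; _≟_; _≤?_; _<?_)
import Data.Nat.Properties as ℕₚ
open import Data.Nat.Properties using (≤-refl; ≤-trans; ≤-reflexive; <-≤-trans; <⇒≤; <⇒≢; n≤1+n; m≤n⇒m≤1+n; +-suc; suc-injective)
open import Data.Product using (_×_; _,_; ∃-syntax)
open import Data.Sum using (inj₁; inj₂)
open import Data.Unit using (⊤; tt)
open import Function using (_∘_)
open import Level using (0ℓ)
open import Relation.Binary.PropositionalEquality as ≡ using (_≡_; _≢_; _≗_)
import Relation.Binary.Reasoning.Setoid as SetoidReasoning
open import Relation.Binary.Structures using (IsEquivalence)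
open import Relation.Nullary using (yes; no)
open import Relation.Nullary.Decidable using (dec-true; dec-false)

-- Formal power series over a commutative semiring.

module PowerSeries (R : CommutativeSemiring 0ℓ 0ℓ) where
  open CommutativeSemiring R
  open SetoidReasoning setoid
  open Solver R using (solve; _:=_; _:+_; _:*_)

  infix  4 _≋_
  infixl 6 _⊕_
  infixl 7 _⊛_

  _≋_ : (f g : ℕ → Carrier) → Set
  f ≋ g = ∀ n → f n ≈ g n

  -- The product peels off the constant term, f = f_0 + z f′, so that the semiring laws follow by
  -- induction on the exponent; `⊛-sum` recovers the Cauchy sum.
  _⊕_ _⊛_ : (f g : ℕ → Carrier) → ℕ → Carrier
  (f ⊕ g) n = f n + g n
  (f ⊛ g) zero    = f 0 * g 0
  (f ⊛ g) (suc n) = f 0 * g (suc n) + ((f ∘ suc) ⊛ g) n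

  monomial : ℕ → Carrier → ℕ → Carrier
  monomial i r n = if i ≡ᵇ n then r else 0#

  𝟘 𝟙 : ℕ → Carrier
  𝟘 _ = 0#
  𝟙 = monomial 0 1#

  ⊛-cong : ∀ {f f′ g g′} → f ≋ f′ → g ≋ g′ → f ⊛ g ≋ f′ ⊛ g′
  ⊛-cong p r zero    = *-cong (p 0) (r 0)
  ⊛-cong p r (suc n) = +-cong (*-cong (p 0) (r (suc n))) (⊛-cong (p ∘ suc) r n)

  ⊛-distribʳ : ∀ h f g → (f ⊕ g) ⊛ h ≋ (f ⊛ h) ⊕ (g ⊛ h)
  ⊛-distribʳ h f g zero    = distribʳ (h 0) (f 0) (g 0)
  ⊛-distribʳ h f g (suc n) = begin
    (f 0 + g 0) * h (suc n) + (((f ∘ suc) ⊕ (g ∘ suc)) ⊛ h) n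
      ≈⟨ +-congˡ (⊛-distribʳ h (f ∘ suc) (g ∘ suc) n) ⟩
    (f 0 + g 0) * h (suc n) + (((f ∘ suc) ⊛ h) n + ((g ∘ suc) ⊛ h) n)
      ≈⟨ solve 5 (λ a b c d e → (a :+ b) :* c :+ (d :+ e) := (a :* c :+ d) :+ (b :* c :+ e))
           refl (f 0) (g 0) (h (suc n)) _ _ ⟩
    (f 0 * h (suc n) + ((f ∘ suc) ⊛ h) n) + (g 0 * h (suc n) + ((g ∘ suc) ⊛ h) n) ∎

  ⊛-zeroˡ : ∀ g → 𝟘 ⊛ g ≋ 𝟘
  ⊛-zeroˡ g zero    = zeroˡ (g 0)
  ⊛-zeroˡ g (suc n) = trans (+-cong (zeroˡ (g (suc n))) (⊛-zeroˡ g n)) (+-identityˡ 0#)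

  ⊛-scaleˡ : ∀ r f g n → ((λ k → r * f k) ⊛ g) n ≈ r * (f ⊛ g) n
  ⊛-scaleˡ r f g zero    = *-assoc r (f 0) (g 0)
  ⊛-scaleˡ r f g (suc n) = begin
    (r * f 0) * g (suc n) + ((λ k → r * f (suc k)) ⊛ g) n
      ≈⟨ +-cong (*-assoc r (f 0) (g (suc n))) (⊛-scaleˡ r (f ∘ suc) g n) ⟩
    r * (f 0 * g (suc n)) + r * ((f ∘ suc) ⊛ g) n
      ≈⟨ distribˡ r _ _ ⟨
    r * (f 0 * g (suc n) + ((f ∘ suc) ⊛ g) n) ∎

  -- Mirror image of the defining equation, peeling g instead of f; comparing the two gives
  -- commutativity.
  ⊛-sucʳ : ∀ f g n → (f ⊛ g) (suc n) ≈ f (suc n) * g 0 + (f ⊛ (g ∘ suc)) n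
  ⊛-sucʳ f g zero    = +-comm (f 0 * g 1) (f 1 * g 0)
  ⊛-sucʳ f g (suc n) = begin
    f 0 * g (2 ℕ.+ n) + ((f ∘ suc) ⊛ g) (suc n)
      ≈⟨ +-congˡ (⊛-sucʳ (f ∘ suc) g n) ⟩
    f 0 * g (2 ℕ.+ n) + (f (2 ℕ.+ n) * g 0 + ((f ∘ suc) ⊛ (g ∘ suc)) n)
      ≈⟨ solve 3 (λ a b c → a :+ (b :+ c) := b :+ (a :+ c)) refl _ _ _ ⟩
    f (2 ℕ.+ n) * g 0 + (f 0 * g (2 ℕ.+ n) + ((f ∘ suc) ⊛ (g ∘ suc)) n) ∎

  ⊛-comm : ∀ f g → f ⊛ g ≋ g ⊛ f
  ⊛-comm f g zero    = *-comm (f 0) (g 0)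
  ⊛-comm f g (suc n) = begin
    f 0 * g (suc n) + ((f ∘ suc) ⊛ g) n  ≈⟨ +-cong (*-comm _ _) (⊛-comm (f ∘ suc) g n) ⟩
    g (suc n) * f 0 + (g ⊛ (f ∘ suc)) n  ≈⟨ ⊛-sucʳ g f n ⟨
    (g ⊛ f) (suc n)                      ∎

  ⊛-scaleʳ : ∀ r f g n → (f ⊛ (λ k → r * g k)) n ≈ r * (f ⊛ g) n
  ⊛-scaleʳ r f g n =
    trans (⊛-comm f (λ k → r * g k) n) (trans (⊛-scaleˡ r g f n) (*-congˡ (⊛-comm g f n)))

  ⊛-assoc : ∀ f g h → (f ⊛ g) ⊛ h ≋ f ⊛ (g ⊛ h)
  ⊛-assoc f g h zero    = *-assoc (f 0) (g 0) (h 0)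
  ⊛-assoc f g h (suc n) = begin
    (f 0 * g 0) * h (suc n) + (((λ k → f 0 * g (suc k)) ⊕ ((f ∘ suc) ⊛ g)) ⊛ h) n
      ≈⟨ +-congˡ (⊛-distribʳ h (λ k → f 0 * g (suc k)) ((f ∘ suc) ⊛ g) n) ⟩
    (f 0 * g 0) * h (suc n) + (((λ k → f 0 * g (suc k)) ⊛ h) n + (((f ∘ suc) ⊛ g) ⊛ h) n)
      ≈⟨ +-congˡ (+-cong (⊛-scaleˡ (f 0) (g ∘ suc) h n) (⊛-assoc (f ∘ suc) g h n)) ⟩
    (f 0 * g 0) * h (suc n) + (f 0 * ((g ∘ suc) ⊛ h) n + ((f ∘ suc) ⊛ (g ⊛ h)) n)
      ≈⟨ solve 5 (λ a b c d e → (a :* b) :* c :+ (a :* d :+ e) := a :* (b :* c :+ d) :+ e)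
           refl (f 0) (g 0) (h (suc n)) _ _ ⟩
    f 0 * (g 0 * h (suc n) + ((g ∘ suc) ⊛ h) n) + ((f ∘ suc) ⊛ (g ⊛ h)) n ∎

  monomial-zero-⊛ : ∀ r g n → (monomial 0 r ⊛ g) n ≈ r * g n
  monomial-zero-⊛ r g zero    = refl
  monomial-zero-⊛ r g (suc n) = trans (+-congˡ (⊛-zeroˡ g n)) (+-identityʳ _)

  *-monomial : ∀ r i s n → r * monomial i s n ≈ monomial i (r * s) n
  *-monomial r i s n with i ≡ᵇ n
  ... | true  = refl
  ... | false = zeroʳ r

  monomial-⊛ : ∀ i j r s → monomial i r ⊛ monomial j s ≋ monomial (i ℕ.+ j) (r * s)
  monomial-⊛ zero    j r s n       = trans (monomial-zero-⊛ r (monomial j s) n) (*-monomial r j s n)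
  monomial-⊛ (suc i) j r s zero    = zeroˡ _
  monomial-⊛ (suc i) j r s (suc n) =
    trans (+-cong (zeroˡ _) (monomial-⊛ i j r s n)) (+-identityˡ _)

  monomial-cong : ∀ i {r s} → r ≈ s → monomial i r ≋ monomial i s
  monomial-cong i e n with i ≡ᵇ n
  ... | true  = e
  ... | false = refl

  sum : ℕ → (ℕ → Carrier) → Carrier
  sum zero    F = F 0
  sum (suc n) F = sum n F + F (suc n)

  sum-cong : ∀ n {F G} → (∀ k → k ≤ n → F k ≈ G k) → sum n F ≈ sum n G
  sum-cong zero    e = e 0 z≤n
  sum-cong (suc n) e = +-cong (sum-cong n λ k k≤n → e k (≤-trans k≤n (n≤1+n n))) (e (suc n) ≤-refl)

  sum-suc : ∀ n F → sum (suc n) F ≈ F 0 + sum n (F ∘ suc)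
  sum-suc zero    F = refl
  sum-suc (suc n) F = trans (+-congʳ (sum-suc n F)) (+-assoc _ _ _)

  ⊛-sum : ∀ f g n → (f ⊛ g) n ≈ sum n (λ k → f k * g (n ∸ k))
  ⊛-sum f g zero    = refl
  ⊛-sum f g (suc n) =
    trans (+-congˡ (⊛-sum (f ∘ suc) g n)) (sym (sum-suc n (λ k → f k * g (suc n ∸ k))))

  powerSeries : CommutativeSemiring 0ℓ 0ℓ
  powerSeries = record
    { Carrier = ℕ → Carrier
    ; _≈_ = _≋_
    ; _+_ = _⊕_
    ; _*_ = _⊛_
    ; 0# = 𝟘
    ; 1# = 𝟙
    ; isCommutativeSemiring = isCommutativeSemiringˡ record
      { +-isCommutativeMonoid = isCommutativeMonoidˡ record
        { isSemigroup = record
          { isMagma = record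
            { isEquivalence = ≋-isEquivalence
            ; ∙-cong = λ p r n → +-cong (p n) (r n) }
          ; assoc = λ f g h n → +-assoc (f n) (g n) (h n) }
        ; identityˡ = λ f n → +-identityˡ (f n)
        ; comm = λ f g n → +-comm (f n) (g n) }
      ; *-isCommutativeMonoid = isCommutativeMonoidˡ record
        { isSemigroup = record
          { isMagma = record { isEquivalence = ≋-isEquivalence ; ∙-cong = ⊛-cong }
          ; assoc = ⊛-assoc }
        ; identityˡ = λ g n → trans (monomial-zero-⊛ 1# g n) (*-identityˡ (g n))
        ; comm = ⊛-comm }
      ; distribʳ = ⊛-distribʳ
      ; zeroˡ = ⊛-zeroˡ } }
    where
    ≋-isEquivalence : IsEquivalence _≋_
    ≋-isEquivalence = record
      { refl = λ n → refl ; sym = λ p n → sym (p n) ; trans = λ p r n → trans (p n) (r n) }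

-- Łukasiewicz path weights and the subset sums `Φ`.

module Paths (R : CommutativeSemiring 0ℓ 0ℓ) (q t x : CommutativeSemiring.Carrier R) where
  open CommutativeSemiring R
  open SetoidReasoning setoid
  open Solver R using (solve; _:=_; _:+_; _:*_; con)
  open PowerSeries R using (_⊛_; ⊛-cong; ⊛-assoc; ⊛-sucʳ; ⊛-scaleˡ; ⊛-scaleʳ)

  infix 8 q^_
  q^_ : ℕ → Carrier
  q^ zero  = 1#
  q^ suc n = q * q^ n

  recordWeight : ℕ → Carrier
  recordWeight zero    = t * x
  recordWeight (suc k) = t * q^ suc k

  recordSteps : (ℕ → Carrier) → ℕ → ℕ → Carrier
  recordSteps w k zero    = 0#
  recordSteps w k (suc s) = recordWeight k * w k + recordSteps w (suc k) s

  -- W k n: total weight of the ways to place the last n letters when k of them lie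
  -- below the current maximum.
  W : ℕ → ℕ → Carrier
  nonRecordStep : ℕ → ℕ → Carrier

  W zero    zero    = 1#
  W (suc k) zero    = 0#
  W k       (suc n) = nonRecordStep k n + recordSteps (λ j → W j n) k (suc n ∸ k)

  nonRecordStep zero    n = 0#
  nonRecordStep (suc k) n = W k n

  -- Φ m h f = Σ q^(sum of S) f(k) over k ≤ m and S ⊆ {0,…,k-1} with h elements, where
  -- k-1 ∈ S (k = 0 if h = 0); the recursion asks whether 0 ∈ S.
  Φ : ℕ → ℕ → (ℕ → Carrier) → Carrier
  Φ m       zero    f = f 0
  Φ zero    (suc h) f = 0#
  Φ (suc m) (suc h) f = q^ suc h * Φ m (suc h) (f ∘ suc) + q^ h * Φ m h (f ∘ suc)

  Φ-⊕ : ∀ m h f g → Φ m h (λ k → f k + g k) ≈ Φ m h f + Φ m h g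
  Φ-⊕ m       zero    f g = refl
  Φ-⊕ zero    (suc h) f g = sym (+-identityˡ 0#)
  Φ-⊕ (suc m) (suc h) f g = begin
    q^ suc h * Φ m (suc h) (λ k → f (suc k) + g (suc k)) + q^ h * Φ m h (λ k → f (suc k) + g (suc k))
      ≈⟨ +-cong (*-congˡ (Φ-⊕ m (suc h) (f ∘ suc) (g ∘ suc))) (*-congˡ (Φ-⊕ m h (f ∘ suc) (g ∘ suc))) ⟩
    q^ suc h * (Φ m (suc h) (f ∘ suc) + Φ m (suc h) (g ∘ suc)) + q^ h * (Φ m h (f ∘ suc) + Φ m h (g ∘ suc))
      ≈⟨ solve 6 (λ a b c d e k → a :* (b :+ c) :+ d :* (e :+ k) := (a :* b :+ d :* e) :+ (a :* c :+ d :* k))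
           refl _ _ _ _ _ _ ⟩
    Φ (suc m) (suc h) f + Φ (suc m) (suc h) g ∎

  Φ-zero : ∀ m h → Φ m h (λ _ → 0#) ≈ 0#
  Φ-zero m       zero    = refl
  Φ-zero zero    (suc h) = refl
  Φ-zero (suc m) (suc h) = begin
    q^ suc h * Φ m (suc h) (λ _ → 0#) + q^ h * Φ m h (λ _ → 0#)
      ≈⟨ +-cong (*-congˡ (Φ-zero m (suc h))) (*-congˡ (Φ-zero m h)) ⟩
    q^ suc h * 0# + q^ h * 0#  ≈⟨ +-cong (zeroʳ _) (zeroʳ _) ⟩
    0# + 0#                    ≈⟨ +-identityˡ 0# ⟩
    0#                         ∎

  -- Here v k = c (q^k w k + ... + q^m w m). Adjoining j ≥ k to a set S with largest element k-1
  -- gives a set with h + 1 elements and largest element j, weighted by w j; asking whether 0 lies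
  -- in it yields the two terms on the right.
  Φ-partialSums : ∀ m h c (v w : ℕ → Carrier) →
    (∀ k → v k ≈ c * q^ k * w k + v (suc k)) → v (suc m) ≈ 0# →
    Φ m h v ≈ c * (q^ suc h * Φ m (suc h) w + q^ h * Φ m h w)
  Φ-partialSums zero zero c v w e z = begin
    v 0                    ≈⟨ e 0 ⟩
    c * 1# * w 0 + v 1     ≈⟨ +-congˡ z ⟩
    c * 1# * w 0 + 0#      ≈⟨ solve 3 (λ c w q → c :* con 1 :* w :+ con 0 := c :* (q :* con 1 :* con 0 :+ con 1 :* w))
                                refl c (w 0) q ⟩
    c * (q * 1# * 0# + 1# * w 0) ∎
  Φ-partialSums zero (suc h) c v w e z =
    solve 3 (λ c a b → con 0 := c :* (a :* con 0 :+ b :* con 0)) refl c _ _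
  Φ-partialSums (suc m) zero c v w e z = begin
    v 0                    ≈⟨ e 0 ⟩
    -- Passing from k to k + 1 turns q^k into q q^k, hence the constant `c * q`.
    c * 1# * w 0 + v 1     ≈⟨ +-congˡ (Φ-partialSums m 0 (c * q) (v ∘ suc) (w ∘ suc)
                                        (λ k → trans (e (suc k)) (+-congʳ (*-congʳ (sym (*-assoc c q _))))) z) ⟩
    c * 1# * w 0 + c * q * (q * 1# * Φ m 1 (w ∘ suc) + 1# * w 1)
      ≈⟨ solve 5 (λ c q a b d → c :* con 1 :* a :+ c :* q :* (q :* con 1 :* d :+ con 1 :* b)
                   := c :* (q :* con 1 :* (q :* con 1 :* d :+ con 1 :* b) :+ con 1 :* a)) refl c q _ _ _ ⟩
    c * (q * 1# * (q * 1# * Φ m 1 (w ∘ suc) + 1# * w 1) + 1# * w 0) ∎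
  Φ-partialSums (suc m) (suc h) c v w e z = begin
    q^ suc h * Φ m (suc h) (v ∘ suc) + q^ h * Φ m h (v ∘ suc)
      ≈⟨ +-cong (*-congˡ (ih (suc h))) (*-congˡ (ih h)) ⟩
    q^ suc h * (c * q * (q^ suc (suc h) * Φ m (suc (suc h)) (w ∘ suc) + q^ suc h * Φ m (suc h) (w ∘ suc)))
    + q^ h * (c * q * (q^ suc h * Φ m (suc h) (w ∘ suc) + q^ h * Φ m h (w ∘ suc)))
      ≈⟨ solve 6 (λ c q p a b d →
           (q :* p) :* (c :* q :* ((q :* (q :* p)) :* a :+ (q :* p) :* b))
           :+ p :* (c :* q :* ((q :* p) :* b :+ p :* d))
           := c :* ((q :* (q :* p)) :* ((q :* (q :* p)) :* a :+ (q :* p) :* b)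
                :+ (q :* p) :* ((q :* p) :* b :+ p :* d))) refl c q (q^ h) _ _ _ ⟩
    c * (q^ suc (suc h) * Φ (suc m) (suc (suc h)) w + q^ suc h * Φ (suc m) (suc h) w) ∎
    where
    ih : ∀ h → _
    ih h = Φ-partialSums m h (c * q) (v ∘ suc) (w ∘ suc)
             (λ k → trans (e (suc k)) (+-congʳ (*-congʳ (sym (*-assoc c q _))))) z

  -- A step lowers the height by at most one. Hence the bound `suc n ∸ k` on the number of record
  -- steps cuts off only zero terms.
  W-vanish : ∀ n k → n < k → W k n ≈ 0#
  W-vanish zero    (suc k) _         = refl
  W-vanish (suc n) (suc k) (s≤s n<k)
    rewrite ℕₚ.m≤n⇒m∸n≡0 (ℕₚ.<⇒≤ n<k) = trans (+-identityʳ _) (W-vanish n k n<k)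

  -- The record part of `W k (suc n)`, a sum over the new heights k′ from k to n.
  V : ℕ → ℕ → Carrier
  V n k = recordSteps (λ j → W j n) k (suc n ∸ k)

  V-vanish : ∀ n k → n < k → V n k ≈ 0#
  V-vanish n k n<k rewrite ℕₚ.m≤n⇒m∸n≡0 n<k = refl

  -- Valid for all k, as `Φ-partialSums` requires: beyond n both sides are 0.
  V-step : ∀ n k → V n k ≈ recordWeight k * W k n + V n (suc k)
  V-step n k with k ℕ.≤? n
  ... | no ¬k≤n = begin
    V n k                              ≈⟨ V-vanish n k n<k ⟩
    0#                                 ≈⟨ trans (+-congʳ (zeroʳ _)) (+-identityˡ 0#) ⟨
    recordWeight k * 0# + 0#           ≈⟨ +-cong (*-congˡ (W-vanish n k n<k)) (V-vanish n (suc k) (ℕₚ.m<n⇒m<1+n n<k)) ⟨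
    recordWeight k * W k n + V n (suc k) ∎
    where n<k = ℕₚ.≰⇒> ¬k≤n
  ... | yes k≤n rewrite ℕₚ.+-∸-assoc 1 k≤n = refl

  V-stepᵠ : ∀ n k → V n (suc k) ≈ t * q * q^ k * W (suc k) n + V n (suc (suc k))
  V-stepᵠ n k = trans (V-step n (suc k)) (+-congʳ (*-congʳ (sym (*-assoc t q (q^ k)))))

  -- `Φ-partialSums` with c = t. In the Motzkin recursion the first term is the up step, the second
  -- the t-part of the level step b_(h+1) = (1 + t) q^(h+1).
  Φ-V : ∀ m h n → n ≤ m →
    Φ m (suc h) (V n) ≈ t * (q^ (2 ℕ.+ h) * Φ m (2 ℕ.+ h) (λ k → W k n) + q^ suc h * Φ m (suc h) (λ k → W k n))
  Φ-V m h n n≤m = trans (irrelevant m) (Φ-partialSums m (suc h) t V′ (λ k → W k n) V′-step (V-vanish n (suc m) (s≤s n≤m)))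
    where
    -- Φ m (suc h) ignores the argument 0, the only one where x enters recordWeight.
    V′ : ℕ → Carrier
    V′ zero    = t * 1# * W 0 n + V n 1
    V′ (suc k) = V n (suc k)

    V′-step : ∀ k → V′ k ≈ t * q^ k * W k n + V′ (suc k)
    V′-step zero    = refl
    V′-step (suc k) = V-step n (suc k)

    irrelevant : ∀ m → Φ m (suc h) (V n) ≈ Φ m (suc h) V′
    irrelevant zero    = refl
    irrelevant (suc m) = refl

  -- `Λ h` is λ_(h+1) = t q^(2h+1), split between the steps joining heights h and h + 1: t q^(h+1)
  -- goes to the up step, q^h to the down step.
  b Λ : ℕ → Carrier
  b zero    = t * x
  b (suc h) = q^ suc h + t * q^ suc h
  Λ h = t * (q^ h * q^ suc h)

  -- The series D = b_h + λ_(h+1) z T. Level h of the fraction is f = 1/(1 - z D), used in the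
  -- subtraction-free form f = 1 + z D f.
  denominator : ℕ → (ℕ → Carrier) → ℕ → Carrier
  denominator h T zero    = b h
  denominator h T (suc k) = Λ h * T k

  -- Motzkin paths in the continued fraction, compared with `Φ`.

  module Fraction
    (T : ℕ → ℕ → ℕ → Carrier)
    (T-head : ∀ h d → T h (suc d) 0 ≈ 1#)
    (T-tail : ∀ h d n → T h (suc d) (suc n) ≈ (denominator h (T (suc h) d) ⊛ T h (suc d)) n)
    where

    -- In power series, E d h = T_h · q^(h-1) z · T_(h-1) · q^(h-2) z ⋯ z · T_0: the Motzkin
    -- paths from height h to 0, cut at their first visits to h - 1, …, 0.  The depth d
    -- is the one available at height h, so that it grows as h decreases.
    E : ℕ → ℕ → ℕ → Carrier
    E d zero    n       = T 0 d n
    E d (suc h) zero    = 0#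
    E d (suc h) (suc n) = q^ h * (T (suc h) d ⊛ E (suc d) h) n

    delay : (ℕ → Carrier) → ℕ → Carrier
    delay f zero    = 0#
    delay f (suc n) = f n

    denominator-⊛ : ∀ h S X n → (denominator h S ⊛ X) n ≈ b h * X n + Λ h * delay (S ⊛ X) n
    denominator-⊛ h S X zero    = sym (trans (+-congˡ (zeroʳ _)) (+-identityʳ _))
    denominator-⊛ h S X (suc n) = +-congˡ (⊛-scaleˡ (Λ h) S X n)

    T-⊛ : ∀ h d X n → (T h (suc d) ⊛ X) (suc n) ≈ X (suc n) + (denominator h (T (suc h) d) ⊛ (T h (suc d) ⊛ X)) n
    T-⊛ h d X n = +-cong
      (trans (*-congʳ (T-head h d)) (*-identityˡ _))
      (trans (⊛-cong (T-tail h d) (λ _ → refl) n) (⊛-assoc _ (T h (suc d)) X n))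

    -- Unfolding two descents exposes the product T_(h+2) · T_(h+1) · E_h, which is what the λ-term
    -- of T_(h+1) produces in `E-step`.
    E-two-up : ∀ d h n → let Y = T (suc h) (suc d) ⊛ E (2 ℕ.+ d) h in
      E d (2 ℕ.+ h) (suc n) ≈ q^ suc h * (q^ h * delay (T (2 ℕ.+ h) d ⊛ Y) n)
    E-two-up d h zero    = *-congˡ (trans (zeroʳ _) (sym (zeroʳ _)))
    E-two-up d h (suc n) = *-congˡ (begin
      (T (2 ℕ.+ h) d ⊛ E (suc d) (suc h)) (suc n)
        ≈⟨ ⊛-sucʳ (T (2 ℕ.+ h) d) (E (suc d) (suc h)) n ⟩
      T (2 ℕ.+ h) d (suc n) * 0# + (T (2 ℕ.+ h) d ⊛ (λ k → q^ h * Y k)) n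
        ≈⟨ trans (+-congʳ (zeroʳ _)) (+-identityˡ _) ⟩
      (T (2 ℕ.+ h) d ⊛ (λ k → q^ h * Y k)) n
        ≈⟨ ⊛-scaleʳ (q^ h) (T (2 ℕ.+ h) d) Y n ⟩
      q^ h * (T (2 ℕ.+ h) d ⊛ Y) n ∎)
      where Y = T (suc h) (suc d) ⊛ E (2 ℕ.+ d) h

    E-ground : ∀ d n → E (suc d) 0 (suc n) ≈ t * q^ 1 * E d 1 n + t * x * E (suc d) 0 n
    E-ground d n = begin
      T 0 (suc d) (suc n)                                  ≈⟨ T-tail 0 d n ⟩
      (denominator 0 (T 1 d) ⊛ T 0 (suc d)) n              ≈⟨ denominator-⊛ 0 (T 1 d) (T 0 (suc d)) n ⟩
      t * x * T 0 (suc d) n + Λ 0 * delay (T 1 d ⊛ T 0 (suc d)) n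
        ≈⟨ +-comm _ _ ⟩
      Λ 0 * delay (T 1 d ⊛ T 0 (suc d)) n + t * x * T 0 (suc d) n
        ≈⟨ +-congʳ (trans (*-congʳ (*-congˡ (*-identityˡ _))) (*-congˡ (delayed n))) ⟩
      t * q^ 1 * E d 1 n + t * x * T 0 (suc d) n           ∎
      where
      delayed : ∀ n → delay (T 1 d ⊛ T 0 (suc d)) n ≈ E d 1 n
      delayed zero    = refl
      delayed (suc n) = sym (*-identityˡ _)

    -- A Motzkin path at height h + 1 begins with an up, level or down step, of weight t q^(h+2),
    -- b_(h+1) or q^h. The sum of depth and height is preserved.
    E-step : ∀ d h n → E (suc d) (suc h) (suc n) ≈
      t * q^ (2 ℕ.+ h) * E d (2 ℕ.+ h) n + b (suc h) * E (suc d) (suc h) n + q^ h * E (2 ℕ.+ d) h n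
    E-step d h zero = begin
      q^ h * (T (suc h) (suc d) 0 * E (2 ℕ.+ d) h 0)
        ≈⟨ *-congˡ (trans (*-congʳ (T-head (suc h) d)) (*-identityˡ _)) ⟩
      q^ h * E (2 ℕ.+ d) h 0
        ≈⟨ solve 3 (λ a b c → c := a :* con 0 :+ b :* con 0 :+ c) refl _ _ _ ⟩
      t * q^ (2 ℕ.+ h) * 0# + b (suc h) * 0# + q^ h * E (2 ℕ.+ d) h 0 ∎
    E-step d h (suc n) = begin
      q^ h * Y (suc n)
        ≈⟨ *-congˡ (trans (T-⊛ (suc h) d X n) (+-congˡ (denominator-⊛ (suc h) S Y n))) ⟩
      q^ h * (X (suc n) + (b (suc h) * Y n + Λ (suc h) * delay (S ⊛ Y) n))
        ≈⟨ solve 6 (λ t q p a c e → let r = q :* p ; s = q :* r in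
             p :* (a :+ ((r :+ t :* r) :* c :+ (t :* (r :* s)) :* e))
             := t :* s :* (r :* (p :* e)) :+ (r :+ t :* r) :* (p :* c) :+ p :* a)
             refl t q (q^ h) _ _ _ ⟩
      t * q^ (2 ℕ.+ h) * (q^ suc h * (q^ h * delay (S ⊛ Y) n)) + b (suc h) * (q^ h * Y n) + q^ h * X (suc n)
        ≈⟨ +-congʳ (+-congʳ (*-congˡ (E-two-up d h n))) ⟨
      t * q^ (2 ℕ.+ h) * E d (2 ℕ.+ h) (suc n) + b (suc h) * E (suc d) (suc h) (suc n) + q^ h * X (suc n) ∎
      where
      X = E (2 ℕ.+ d) h
      S = T (2 ℕ.+ h) d
      Y = T (suc h) (suc d) ⊛ X

    -- Induction on n by first steps. The bound n < d hides the truncation of the fraction, since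
    -- only an up step lowers d, and by one; n ≤ m ensures that the cutoff k ≤ m omits only zeros,
    -- by `W-vanish`.
    E≈Φ : ∀ n d m h → n < d → n ≤ m → E d h n ≈ Φ m h (λ k → W k n)
    E≈Φ zero (suc d) m zero    _ _ = T-head 0 d
    E≈Φ zero (suc d) zero    (suc h) _ _ = refl
    -- At positive height only positive arguments k are evaluated, and there `W k 0` is 0.
    E≈Φ zero (suc d) (suc m) (suc h) _ _ = sym (Φ-zero (suc m) (suc h))
    E≈Φ (suc n) (suc d) (suc m) zero (s≤s n<d) (s≤s n≤m) = begin
      E (suc d) 0 (suc n)                                ≈⟨ E-ground d n ⟩
      t * q^ 1 * E d 1 n + t * x * E (suc d) 0 n
        ≈⟨ +-cong (*-congˡ (E≈Φ n d (suc m) 1 n<d (ℕₚ.m≤n⇒m≤1+n n≤m)))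
                  (*-congˡ (E≈Φ n (suc d) m 0 (ℕₚ.m<n⇒m<1+n n<d) n≤m)) ⟩
      t * q^ 1 * Φ (suc m) 1 w + t * x * w 0
        ≈⟨ solve 5 (λ t q x a c → t :* (q :* con 1) :* (q :* con 1 :* c :+ con 1 :* a) :+ x
             := con 0 :+ (x :+ t :* q :* (q :* con 1 :* c :+ con 1 :* a))) refl t q (t * x * w 0) _ _ ⟩
      -- The record with k′ = 0 carries x and stands apart; the others, shifted by one, form partial
      -- sums with c = t q.
      0# + (t * x * w 0 + t * q * (q^ 1 * Φ m 1 (w ∘ suc) + q^ 0 * w 1))
        ≈⟨ +-congˡ (+-congˡ (Φ-partialSums m 0 (t * q) (V n ∘ suc) (w ∘ suc) (V-stepᵠ n) (V-vanish n (2 ℕ.+ m) (s≤s (ℕₚ.m≤n⇒m≤1+n n≤m))))) ⟨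
      0# + (t * x * w 0 + V n 1)   ≈⟨ +-congˡ (V-step n 0) ⟨
      W 0 (suc n)                  ∎
      where w = λ k → W k n
    E≈Φ (suc n) (suc d) (suc m) (suc h) (s≤s n<d) (s≤s n≤m) = begin
      E (suc d) (suc h) (suc n)  ≈⟨ E-step d h n ⟩
      t * q^ (2 ℕ.+ h) * E d (2 ℕ.+ h) n + b (suc h) * E (suc d) (suc h) n + q^ h * E (2 ℕ.+ d) h n
        ≈⟨ +-congʳ (+-congˡ (distribʳ _ _ _)) ⟩
      t * q^ (2 ℕ.+ h) * E d (2 ℕ.+ h) n
      + (q^ suc h * E (suc d) (suc h) n + t * q^ suc h * E (suc d) (suc h) n) + q^ h * E (2 ℕ.+ d) h n
        ≈⟨ +-cong
             (+-cong (*-congˡ (E≈Φ n d (suc m) (2 ℕ.+ h) n<d n≤1+m))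
               (+-cong (*-congˡ (E≈Φ n (suc d) m (suc h) n<1+d n≤m))
                       (*-congˡ (E≈Φ n (suc d) (suc m) (suc h) n<1+d n≤1+m))))
             (*-congˡ (E≈Φ n (2 ℕ.+ d) m h (ℕₚ.m<n⇒m<1+n n<1+d) n≤m)) ⟩
      t * q^ (2 ℕ.+ h) * Φ (suc m) (2 ℕ.+ h) w
      + (q^ suc h * Φ m (suc h) w + t * q^ suc h * Φ (suc m) (suc h) w) + q^ h * Φ m h w
        ≈⟨ solve 8 (λ t r s p a₂ a₁′ a₁ a₀ →
             t :* r :* a₂ :+ (s :* a₁′ :+ t :* s :* a₁) :+ p :* a₀
             := (s :* a₁′ :+ p :* a₀) :+ t :* (r :* a₂ :+ s :* a₁))
             refl t (q^ (2 ℕ.+ h)) (q^ suc h) (q^ h) _ _ _ _ ⟩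
      -- Here `delay` shifts the height, not the power of z, and gives the non-record part of
      -- `W k (suc n)`. The recursion of `Φ` turns it into the down step and the t-free part of the
      -- level step.
      Φ (suc m) (suc h) (delay w)
      + t * (q^ (2 ℕ.+ h) * Φ (suc m) (2 ℕ.+ h) w + q^ suc h * Φ (suc m) (suc h) w)
        ≈⟨ +-congˡ (Φ-V (suc m) h n n≤1+m) ⟨
      Φ (suc m) (suc h) (delay w) + Φ (suc m) (suc h) (V n)
        ≈⟨ Φ-⊕ (suc m) (suc h) (delay w) (V n) ⟨
      Φ (suc m) (suc h) (λ k → W k (suc n)) ∎
      where
      w = λ k → W k n
      n≤1+m = ℕₚ.m≤n⇒m≤1+n n≤m
      n<1+d = ℕₚ.m<n⇒m<1+n n<d

-- Boolean comparisons and counting.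

open import Data.Nat using (_+_)
open ≡ using (refl; cong; cong₂; sym; trans; subst)

≤⇒≤ᵇ-true : ∀ {m n} → m ≤ n → (m ≤ᵇ n) ≡ true
≤⇒≤ᵇ-true {m} {n} m≤n = dec-true (m ≤? n) m≤n

>⇒≤ᵇ-false : ∀ {m n} → n < m → (m ≤ᵇ n) ≡ false
>⇒≤ᵇ-false {m} {n} n<m = dec-false (m ≤? n) (ℕₚ.<⇒≱ n<m)

<ᵇ-true : ∀ {m n} → m < n → (m <ᵇ n) ≡ true
<ᵇ-true {m} {n} p = dec-true (m <? n) p

<ᵇ-false : ∀ {m n} → n ≤ m → (m <ᵇ n) ≡ false
<ᵇ-false {m} {n} p = dec-false (m <? n) (ℕₚ.≤⇒≯ p)

≡ᵇ-true : ∀ n → (n ≡ᵇ n) ≡ true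
≡ᵇ-true n = dec-true (n ≟ n) refl

≡ᵇ-false : ∀ {m n} → m ≢ n → (m ≡ᵇ n) ≡ false
≡ᵇ-false {m} {n} p = dec-false (m ≟ n) p

countB-++ : ∀ (p : ℕ → Bool) X Y → countB p (X ++ Y) ≡ countB p X + countB p Y
countB-++ p []      Y = refl
countB-++ p (a ∷ X) Y = trans (cong ((if p a then 1 else 0) +_) (countB-++ p X Y))
  (sym (ℕₚ.+-assoc (if p a then 1 else 0) (countB p X) (countB p Y)))

countB-insert : ∀ (p : ℕ → Bool) X a Y →
  countB p (X ++ a ∷ Y) ≡ (if p a then 1 else 0) + countB p (X ++ Y)
countB-insert p []      a Y = refl
countB-insert p (b ∷ X) a Y = trans (cong ((if p b then 1 else 0) +_) (countB-insert p X a Y))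
  (x∙yz≈y∙xz (if p b then 1 else 0) (if p a then 1 else 0) _)
  where open import Algebra.Properties.CommutativeSemigroup ℕₚ.+-commutativeSemigroup using (x∙yz≈y∙xz)

countB-below : ∀ {a X} → All (_< a) X → countB (_<ᵇ a) X ≡ length X
countB-below []      = refl
countB-below (p ∷ ps) rewrite <ᵇ-true p = cong suc (countB-below ps)

countB-above : ∀ {a X} → All (a ≤_) X → countB (_<ᵇ a) X ≡ 0
countB-above []       = refl
countB-above (p ∷ ps) rewrite <ᵇ-false p = countB-above ps

-- Sums over words and over arrangements of a list.

module Arrangements (R : CommutativeSemiring 0ℓ 0ℓ) where
  open CommutativeSemiring R using (Carrier; _≈_; 0#; setoid; +-cong; +-congˡ; +-assoc; +-comm; +-identityˡ; zeroʳ; distribˡ; reflexive)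
    renaming (_+_ to _⊕_; _*_ to _⊛_; refl to ≈-refl; sym to ≈-sym; trans to ≈-trans)
  open SetoidReasoning setoid

  private variable A B : Set

  sumL : (A → Carrier) → List A → Carrier
  sumL f []      = 0#
  sumL f (a ∷ l) = f a ⊕ sumL f l

  sumL-cong : ∀ {f g : A → Carrier} {l} → All (λ a → f a ≈ g a) l → sumL f l ≈ sumL g l
  sumL-cong []       = ≈-refl
  sumL-cong (e ∷ es) = +-cong e (sumL-cong es)

  sumL-zero : ∀ (l : List A) → sumL (λ _ → 0#) l ≈ 0#
  sumL-zero []      = ≈-refl
  sumL-zero (a ∷ l) = ≈-trans (+-identityˡ _) (sumL-zero l)

  sumL-++ : ∀ (f : A → Carrier) k l → sumL f (k ++ l) ≈ sumL f k ⊕ sumL f l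
  sumL-++ f []      l = ≈-sym (+-identityˡ _)
  sumL-++ f (a ∷ k) l = ≈-trans (+-congˡ (sumL-++ f k l)) (≈-sym (+-assoc _ _ _))

  sumL-map : ∀ (f : B → Carrier) (g : A → B) l → sumL f (map g l) ≡ sumL (f ∘ g) l
  sumL-map f g []      = refl
  sumL-map f g (a ∷ l) = cong (f (g a) ⊕_) (sumL-map f g l)

  sumL-concatMap : ∀ (f : B → Carrier) (g : A → List B) l →
    sumL f (concatMap g l) ≈ sumL (λ a → sumL f (g a)) l
  sumL-concatMap f g []      = ≈-refl
  sumL-concatMap f g (a ∷ l) = ≈-trans (sumL-++ f (g a) (concatMap g l)) (+-congˡ (sumL-concatMap f g l))

  -- sumWords r A sums over all words of length r in the letters A, and sumArr r A over
  -- the words that use every list entry at most once; pick r X Y is the part of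
  -- sumArr (suc r) (X ++ Y) in which the first letter is taken from Y.
  sumWords : ℕ → List ℕ → (List ℕ → Carrier) → Carrier
  sumWords zero    A f = f []
  sumWords (suc r) A f = sumL (λ a → sumWords r A (f ∘ (a ∷_))) A

  sumL-words : ∀ r k f → sumL f (words r k) ≈ sumWords r (range k) f
  sumL-words zero    k f = ≈-trans (+-comm _ _) (+-identityˡ _)
  sumL-words (suc r) k f = ≈-trans (sumL-concatMap f (λ a → map (a ∷_) (words r k)) (range k))
    (sumL-cong (All.universal (λ a → ≈-trans (reflexive (sumL-map f (a ∷_) (words r k)))
                                             (sumL-words r k (f ∘ (a ∷_)))) (range k)))

  sumWords-cong : ∀ r A {f g} → (∀ w → f w ≈ g w) → sumWords r A f ≈ sumWords r A g
  sumWords-cong zero    A e = e []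
  sumWords-cong (suc r) A e = sumL-cong (All.universal (λ a → sumWords-cong r A (e ∘ (a ∷_))) A)

  sumWords-zero : ∀ r A → sumWords r A (λ _ → 0#) ≈ 0#
  sumWords-zero zero    A = ≈-refl
  sumWords-zero (suc r) A = ≈-trans (sumL-cong (All.universal (λ _ → sumWords-zero r A) A)) (sumL-zero A)

  sumWords-avoiding : ∀ r X a Y f → All (a ≢_) X → All (a ≢_) Y →
    sumWords r (X ++ a ∷ Y) (λ w → if anyB (a ≡ᵇ_) w then 0# else f w) ≈ sumWords r (X ++ Y) f
  sumWords-avoiding zero    X a Y f a∉X a∉Y = ≈-refl
  sumWords-avoiding (suc r) X a Y f a∉X a∉Y = begin
    sumL g (X ++ a ∷ Y)        ≈⟨ sumL-++ g X (a ∷ Y) ⟩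
    sumL g X ⊕ (g a ⊕ sumL g Y)
      ≈⟨ +-cong (sumL-cong (All.map g-other a∉X)) (+-cong g-self (sumL-cong (All.map g-other a∉Y))) ⟩
    sumL h X ⊕ (0# ⊕ sumL h Y) ≈⟨ +-congˡ (+-identityˡ _) ⟩
    sumL h X ⊕ sumL h Y        ≈⟨ sumL-++ h X Y ⟨
    sumL h (X ++ Y)            ∎
    where
    g h : ℕ → Carrier
    g b = sumWords r (X ++ a ∷ Y) (λ w → if (a ≡ᵇ b) ∨ anyB (a ≡ᵇ_) w then 0# else f (b ∷ w))
    h b = sumWords r (X ++ Y) (f ∘ (b ∷_))

    g-self : g a ≈ 0#
    g-self rewrite ≡ᵇ-true a = sumWords-zero r (X ++ a ∷ Y)

    g-other : ∀ {b} → a ≢ b → g b ≈ h b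
    g-other {b} a≢b rewrite ≡ᵇ-false a≢b = sumWords-avoiding r X a Y (f ∘ (b ∷_)) a∉X a∉Y

  sumArr : ℕ → List ℕ → (List ℕ → Carrier) → Carrier
  pick : ℕ → List ℕ → List ℕ → (List ℕ → Carrier) → Carrier

  sumArr zero    A f = f []
  sumArr (suc r) A f = pick r [] A f

  pick r X []      f = 0#
  pick r X (a ∷ Y) f = sumArr r (X ++ Y) (f ∘ (a ∷_)) ⊕ pick r (X ∷ʳ a) Y f

  -- Only rearrangements of A occur. They are described by the counts of all predicates because the
  -- later arguments need just the number of remaining letters below a given one.
  sumArr-cong : ∀ r A {f g} → length A ≡ r → (∀ w → (∀ p → countB p w ≡ countB p A) → f w ≈ g w) →
    sumArr r A f ≈ sumArr r A g
  pick-cong : ∀ r X Y {f g} → length X + length Y ≡ suc r →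
    (∀ w → (∀ p → countB p w ≡ countB p (X ++ Y)) → f w ≈ g w) →
    pick r X Y f ≈ pick r X Y g

  sumArr-cong zero    [] _ e = e [] (λ p → refl)
  sumArr-cong (suc r) A  l e = pick-cong r [] A l e

  pick-cong r X []      l e = ≈-refl
  pick-cong r X (a ∷ Y) l e = +-cong
    (sumArr-cong r (X ++ Y) (trans (length-++ X) (suc-injective (trans (sym (+-suc (length X) (length Y))) l)))
      (λ w c → e (a ∷ w) (λ p → trans (cong ((if p a then 1 else 0) +_) (c p)) (sym (countB-insert p X a Y)))))
    (pick-cong r (X ∷ʳ a) Y
      (trans (cong (_+ length Y) (trans (length-++ X) (ℕₚ.+-comm (length X) 1))) (trans (sym (+-suc (length X) (length Y))) l))
      (λ w c → e w (λ p → trans (c p) (cong (countB p) (∷ʳ-++ X a Y)))))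

  sumArr-scale : ∀ r A c f → sumArr r A (λ w → c ⊛ f w) ≈ c ⊛ sumArr r A f
  pick-scale : ∀ r X Y c f → pick r X Y (λ w → c ⊛ f w) ≈ c ⊛ pick r X Y f
  sumArr-scale zero    A c f = ≈-refl
  sumArr-scale (suc r) A c f = pick-scale r [] A c f
  pick-scale r X []      c f = ≈-sym (zeroʳ c)
  pick-scale r X (a ∷ Y) c f = ≈-trans
    (+-cong (sumArr-scale r (X ++ Y) c (f ∘ (a ∷_))) (pick-scale r (X ∷ʳ a) Y c f))
    (≈-sym (distribˡ c _ _))

  sumArr-zero : ∀ r A → sumArr r A (λ _ → 0#) ≈ 0#
  pick-zero : ∀ r X Y → pick r X Y (λ _ → 0#) ≈ 0#
  sumArr-zero zero    A = ≈-refl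
  sumArr-zero (suc r) A = pick-zero r [] A
  pick-zero r X []      = ≈-refl
  pick-zero r X (a ∷ Y) =
    ≈-trans (+-cong (sumArr-zero r (X ++ Y)) (pick-zero r (X ∷ʳ a) Y)) (+-identityˡ 0#)

  ifDistinct : (List ℕ → Carrier) → List ℕ → Carrier
  ifDistinct f w = if distinct w then f w else 0#

  split-unique : ∀ (X : List ℕ) {a Y} → Unique (X ++ a ∷ Y) → All (a ≢_) X × All (a ≢_) Y × Unique (X ++ Y)
  split-unique []      (a∉Y ∷ u) = [] , a∉Y , u
  split-unique (b ∷ X) (b∉ ∷ u) with split-unique X u | Allₚ.++⁻ X b∉
  ... | a∉X , a∉Y , v | b∉X , (b≢a ∷ b∉Y) = (b≢a ∘ sym) ∷ a∉X , a∉Y , Allₚ.++⁺ b∉X b∉Y ∷ v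

  -- Once the first letter a is fixed, the rest is a distinct word without a, that is, one over the
  -- list with a removed.
  sumWords-distinct : ∀ r A f → Unique A → sumWords r A (ifDistinct f) ≈ sumArr r A f
  sumWords-pick : ∀ r X Y f → Unique (X ++ Y) →
    sumL (λ a → sumWords r (X ++ Y) (ifDistinct f ∘ (a ∷_))) Y ≈ pick r X Y f

  sumWords-distinct zero    A f u = ≈-refl
  sumWords-distinct (suc r) A f u = sumWords-pick r [] A f u

  sumWords-pick r X []      f u = ≈-refl
  sumWords-pick r X (a ∷ Y) f u = let a∉X , a∉Y , v = split-unique X u in +-cong
    (≈-trans (sumWords-cong r (X ++ a ∷ Y) nested)
      (≈-trans (sumWords-avoiding r X a Y (ifDistinct (f ∘ (a ∷_))) a∉X a∉Y)
               (sumWords-distinct r (X ++ Y) (f ∘ (a ∷_)) v)))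
    (subst (λ A → sumL (λ b → sumWords r A (ifDistinct f ∘ (b ∷_))) Y ≈ pick r (X ∷ʳ a) Y f) (∷ʳ-++ X a Y)
      (sumWords-pick r (X ∷ʳ a) Y f (subst Unique (sym (∷ʳ-++ X a Y)) u)))
    where
    nested : ∀ w → ifDistinct f (a ∷ w) ≈ (if anyB (a ≡ᵇ_) w then 0# else ifDistinct (f ∘ (a ∷_)) w)
    nested w with anyB (a ≡ᵇ_) w
    ... | true  = ≈-refl
    ... | false = ≈-refl

-- Polynomials as iterated power series.

sum-coefficient : ∀ (R : CommutativeSemiring 0ℓ 0ℓ) n F m →
  PowerSeries.sum (PowerSeries.powerSeries R) n F m ≡ PowerSeries.sum R n (λ k → F k m)
sum-coefficient R zero    F m = refl
sum-coefficient R (suc n) F m =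
  cong (λ s → CommutativeSemiring._+_ R s (F (suc n) m)) (sum-coefficient R n F m)

-- The coefficient functions of Poly have no finiteness condition: they are power series.
ℕ⟦x⟧ ℕ⟦t,x⟧ ℕ⟦q,t,x⟧ : CommutativeSemiring 0ℓ 0ℓ
ℕ⟦x⟧     = PowerSeries.powerSeries ℕₚ.+-*-commutativeSemiring
ℕ⟦t,x⟧   = PowerSeries.powerSeries ℕ⟦x⟧
ℕ⟦q,t,x⟧ = PowerSeries.powerSeries ℕ⟦t,x⟧

module X = PowerSeries ℕₚ.+-*-commutativeSemiring
module TX = PowerSeries ℕ⟦x⟧
module QTX = PowerSeries ℕ⟦t,x⟧
open CommutativeSemiring ℕ⟦q,t,x⟧
  using (_≈_; 0#; 1#; setoid; +-cong; +-congˡ; *-cong; *-congʳ; *-congˡ; zeroʳ; +-identityˡ; reflexive)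
  renaming (_+_ to _⊕_; _*_ to _⊛_; refl to ≈-refl; sym to ≈-sym; trans to ≈-trans)
open SetoidReasoning setoid

sumTo-cong : ∀ n {f g : ℕ → ℕ} → (∀ k → f k ≡ g k) → sumTo n f ≡ sumTo n g
sumTo-cong zero    e = e 0
sumTo-cong (suc n) e = cong₂ _+_ (sumTo-cong n e) (e (suc n))

sum≡sumTo : ∀ n f → X.sum n f ≡ sumTo n f
sum≡sumTo zero    f = refl
sum≡sumTo (suc n) f = cong (_+ f (suc n)) (sum≡sumTo n f)

-- Each nested `sumTo` is the Cauchy product in one of the variables q, t, x, and taking
-- coefficients commutes with finite sums.
*P-⊛ : ∀ p r → p *P r ≈ p ⊛ r
*P-⊛ p r a b c = sym (trans (QTX.⊛-sum p r a b c) (trans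
  (trans (cong (λ f → f c) (sum-coefficient ℕ⟦x⟧ a _ b))
    (trans (sum-coefficient ℕₚ.+-*-commutativeSemiring a _ c) (sum≡sumTo a _)))
  (sumTo-cong a λ i → trans (TX.⊛-sum (p i) (r (a ∸ i)) b c) (trans
    (trans (sum-coefficient ℕₚ.+-*-commutativeSemiring b _ c) (sum≡sumTo b _))
    (sumTo-cong b λ j → trans (X.⊛-sum (p i j) (r (a ∸ i) (b ∸ j)) c) (sum≡sumTo c _))))))

mono-monomial : ∀ i j k → mono i j k ≈ QTX.monomial i (TX.monomial j (X.monomial k 1))
mono-monomial i j k a b c with i ≡ᵇ a
... | false = refl
... | true with j ≡ᵇ b
...   | false = refl
...   | true with k ≡ᵇ c
...     | false = refl
...     | true  = refl

mono-⊛ : ∀ i j k i′ j′ k′ → mono i j k ⊛ mono i′ j′ k′ ≈ mono (i + i′) (j + j′) (k + k′)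
mono-⊛ i j k i′ j′ k′ = begin
  mono i j k ⊛ mono i′ j′ k′
    ≈⟨ QTX.⊛-cong (mono-monomial i j k) (mono-monomial i′ j′ k′) ⟩
  QTX.monomial i (TX.monomial j (X.monomial k 1)) ⊛ QTX.monomial i′ (TX.monomial j′ (X.monomial k′ 1))
    ≈⟨ QTX.monomial-⊛ i i′ _ _ ⟩
  QTX.monomial (i + i′) (TX.monomial j (X.monomial k 1) TX.⊛ TX.monomial j′ (X.monomial k′ 1))
    ≈⟨ QTX.monomial-cong (i + i′) (TX.monomial-⊛ j j′ _ _) ⟩
  QTX.monomial (i + i′) (TX.monomial (j + j′) (X.monomial k 1 X.⊛ X.monomial k′ 1))
    ≈⟨ QTX.monomial-cong (i + i′) (TX.monomial-cong (j + j′) (X.monomial-⊛ k k′ 1 1)) ⟩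
  QTX.monomial (i + i′) (TX.monomial (j + j′) (X.monomial (k + k′) 1))
    ≈⟨ mono-monomial (i + i′) (j + j′) (k + k′) ⟨
  mono (i + i′) (j + j′) (k + k′) ∎

open Paths ℕ⟦q,t,x⟧ (mono 1 0 0) (mono 0 1 0) (mono 0 0 1)

q^≈mono : ∀ n → q^ n ≈ mono n 0 0
q^≈mono zero    = ≈-sym (mono-monomial 0 0 0)
q^≈mono (suc n) = ≈-trans (*-congˡ (q^≈mono n)) (mono-⊛ 1 0 0 n 0 0)

t*q^≈mono : ∀ n → mono 0 1 0 ⊛ (q^ n) ≈ mono n 1 0
t*q^≈mono n = ≈-trans (*-congˡ (q^≈mono n)) (mono-⊛ 0 1 0 n 0 0)

recordWeight≈mono : ∀ k → recordWeight k ≈ mono k 1 (if k ≡ᵇ 0 then 1 else 0)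
recordWeight≈mono zero    = mono-⊛ 0 1 0 0 0 1
recordWeight≈mono (suc k) = t*q^≈mono (suc k)

b≈bcoef : ∀ h → b h ≈ bcoef h
b≈bcoef zero    = mono-⊛ 0 1 0 0 0 1
b≈bcoef (suc h) = +-cong (q^≈mono (suc h)) (t*q^≈mono (suc h))

Λ≈lam : ∀ h → Λ h ≈ lam (suc h)
Λ≈lam h = begin
  mono 0 1 0 ⊛ ((q^ h) ⊛ (q^ suc h))
    ≈⟨ *-congˡ (≈-trans (*-cong (q^≈mono h) (q^≈mono (suc h))) (mono-⊛ h 0 0 (suc h) 0 0)) ⟩
  mono 0 1 0 ⊛ mono (h + suc h) 0 0  ≈⟨ mono-⊛ 0 1 0 (h + suc h) 0 0 ⟩
  mono (h + suc h) 1 0               ≡⟨ cong (λ k → mono (h + suc k) 1 0) (ℕₚ.+-identityʳ h) ⟨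
  lam (suc h)                        ∎

-- Truncations of the continued fraction.

module Z = PowerSeries ℕ⟦q,t,x⟧

-- The guard in `approx` makes each approximation keep all coefficients of the previous one.
approx-stable : ∀ H n m → m ≤ n → approx H n m ≡ invZ H m
approx-stable H zero    zero z≤n = refl
approx-stable H (suc n) m    m≤1+n with ℕₚ.m≤n⇒m<n∨m≡n m≤1+n
... | inj₂ refl      = refl
... | inj₁ (s≤s m≤n) rewrite ≤⇒≤ᵇ-true m≤n = approx-stable H n m m≤n

sumPTo≡sum : ∀ n F → sumPTo n F ≡ Z.sum n F
sumPTo≡sum zero    F = refl
sumPTo≡sum (suc n) F = cong (_+P F (suc n)) (sumPTo≡sum n F)

invZ-suc : ∀ H n → invZ H (suc n) ≈ (H Z.⊛ invZ H) n
invZ-suc H n rewrite >⇒≤ᵇ-false (ℕₚ.n<1+n n) = begin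
  sumPTo n (λ k → H k *P approx H n (n ∸ k))  ≡⟨ sumPTo≡sum n _ ⟩
  Z.sum n (λ k → H k *P approx H n (n ∸ k))
    ≈⟨ Z.sum-cong n (λ k _ → begin
         H k *P approx H n (n ∸ k)   ≡⟨ cong (H k *P_) (approx-stable H n (n ∸ k) (ℕₚ.m∸n≤m n k)) ⟩
         H k *P invZ H (n ∸ k)       ≈⟨ *P-⊛ (H k) (invZ H (n ∸ k)) ⟩
         H k ⊛ invZ H (n ∸ k)        ∎) ⟩
  Z.sum n (λ k → H k ⊛ invZ H (n ∸ k))        ≈⟨ Z.⊛-sum H (invZ H) n ⟨
  (H Z.⊛ invZ H) n                            ∎

tailCF-head : ∀ h d → tailCF h (suc d) 0 ≈ 1#
tailCF-head h d = mono-monomial 0 0 0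

tailCF-tail : ∀ h d n →
  tailCF h (suc d) (suc n) ≈ (denominator h (tailCF (suc h) d) Z.⊛ tailCF h (suc d)) n
tailCF-tail h d n = ≈-trans (invZ-suc _ n) (Z.⊛-cong {g = tailCF h (suc d)} coefficients (λ _ → ≈-refl) n)
  where
  coefficients : ∀ k → _ ≈ denominator h (tailCF (suc h) d) k
  coefficients zero    = ≈-sym (b≈bcoef h)
  coefficients (suc k) =
    ≈-trans (*P-⊛ (lam (suc h)) (tailCF (suc h) d k)) (QTX.⊛-cong (≈-sym (Λ≈lam h)) (λ _ _ _ → refl))

open Fraction tailCF tailCF-head tailCF-tail

JF≈W : ∀ n m → n < m → JF m n ≈ W 0 n
JF≈W n m n<m = E≈Φ n m n 0 n<m ≤-refl

-- 321-avoiding permutations built letter by letter.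

open Arrangements ℕ⟦q,t,x⟧

-- θ stands for the current maximum and i for the position of the next letter.
records : ℕ → List ℕ → ℕ
records θ []      = 0
records θ (a ∷ w) = if θ ≤ᵇ a then suc (records a w) else records θ w

-- Contribution of the letters w still to come. Among the placed letters, θ alone decides whether
-- one of them begins a 321 whose last two letters lie in w; a 321 with its middle letter already
-- placed was detected earlier.
weight : ℕ → ℕ → List ℕ → Poly
weight θ i w = if has321 w ∨ pat21 θ w then 0# else mono (inv w) (records θ w) (fixFrom i w)

up : ℕ → ℕ → List ℕ
up M zero    = []
up M (suc s) = M ∷ up (suc M) s

up-≥ : ∀ M s → All (M ≤_) (up M s)
up-≥ M zero    = []
up-≥ M (suc s) = ≤-refl ∷ All.map (≤-trans (ℕₚ.n≤1+n M)) (up-≥ (suc M) s)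

length-up : ∀ M s → length (up M s) ≡ s
length-up M zero    = refl
length-up M (suc s) = cong suc (length-up (suc M) s)

anyB≡count : ∀ (p : ℕ → Bool) w → anyB p w ≡ (1 ≤ᵇ countB p w)
anyB≡count p []      = refl
anyB≡count p (a ∷ w) with p a
... | true  = refl
... | false = anyB≡count p w

pat21-none : ∀ a w → countB (_<ᵇ a) w ≡ 0 → pat21 a w ≡ false
pat21-none a []      _ = refl
pat21-none a (b ∷ w) e with b <ᵇ a
... | false = pat21-none a w e

pat21-mono : ∀ {θ a} w → θ ≤ a → pat21 θ w ≡ true → pat21 a w ≡ true
pat21-mono {θ} {a} (b ∷ w) θ≤a e with b <? θ
... | no  b≮θ rewrite <ᵇ-false (ℕₚ.≮⇒≥ b≮θ) | pat21-mono w θ≤a e = ∨-zeroʳ _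
... | yes b<θ rewrite <ᵇ-true b<θ | <ᵇ-true (<-≤-trans b<θ θ≤a) with anyB (_<ᵇ b) w
...   | true  = refl
...   | false = pat21-mono w θ≤a e

-- A 21 below θ is also below the new maximum a, so the condition for θ is implied by the one for a.
pat21-absorb : ∀ {θ a} w → θ ≤ a → (pat21 a w ∨ has321 w) ∨ pat21 θ w ≡ has321 w ∨ pat21 a w
pat21-absorb {θ} {a} w θ≤a with pat21 θ w in eq
... | false = trans (∨-identityʳ _) (∨-comm (pat21 a w) (has321 w))
... | true rewrite pat21-mono w θ≤a eq = sym (∨-zeroʳ (has321 w))

-- The j smaller letters still to come are the inversions that a begins. Since a = i + j, it is a
-- fixed point exactly when j = 0.
weight-record : ∀ {θ a} i j w → θ ≤ a → i + j ≡ a → countB (_<ᵇ a) w ≡ j →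
  weight θ i (a ∷ w) ≈ recordWeight j ⊛ weight a (suc i) w
weight-record {θ} i j w θ≤a refl e
  rewrite e | <ᵇ-false θ≤a | ≤⇒≤ᵇ-true θ≤a | pat21-absorb w θ≤a with has321 w ∨ pat21 (i + j) w
... | true  = ≈-sym (zeroʳ (recordWeight j))
... | false = ≈-sym (begin
  recordWeight j ⊛ mono (inv w) (records (i + j) w) (fixFrom (suc i) w)
    ≈⟨ *-congʳ (recordWeight≈mono j) ⟩
  mono j 1 (if j ≡ᵇ 0 then 1 else 0) ⊛ mono (inv w) (records (i + j) w) (fixFrom (suc i) w)
    ≈⟨ mono-⊛ j 1 (if j ≡ᵇ 0 then 1 else 0) (inv w) (records (i + j) w) (fixFrom (suc i) w) ⟩
  mono (j + inv w) (suc (records (i + j) w)) ((if j ≡ᵇ 0 then 1 else 0) + fixFrom (suc i) w)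
    ≡⟨ cong (λ b → mono (j + inv w) (suc (records (i + j) w)) ((if b then 1 else 0) + fixFrom (suc i) w)) (fixed j) ⟩
  mono (j + inv w) (suc (records (i + j) w)) ((if i + j ≡ᵇ i then 1 else 0) + fixFrom (suc i) w) ∎)
  where
  fixed : ∀ j → (j ≡ᵇ 0) ≡ (i + j ≡ᵇ i)
  fixed zero    rewrite ℕₚ.+-identityʳ i = sym (≡ᵇ-true i)
  fixed (suc j) = sym (≡ᵇ-false (ℕₚ.m+1+n≢m i))

-- With nothing smaller to come, q begins no inversion and is the middle of no 321; q < i rules out
-- a fixed point.
weight-nonrecord : ∀ {θ i q} w → q < θ → q < i → countB (_<ᵇ q) w ≡ 0 →
  weight θ i (q ∷ w) ≡ weight θ (suc i) w
weight-nonrecord {θ} {i} {q} w q<θ q<i none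
  rewrite pat21-none q w none | anyB≡count (_<ᵇ q) w | none | <ᵇ-true q<θ
        | >⇒≤ᵇ-false q<θ | ≡ᵇ-false (<⇒≢ q<i) = refl

-- θ, q and a smaller letter to come form a 321.
weight-late : ∀ {θ i q n} w → q < θ → countB (_<ᵇ q) w ≡ suc n → weight θ i (q ∷ w) ≡ 0#
weight-late {θ} {i} {q} w q<θ some
  rewrite anyB≡count (_<ᵇ q) w | some | <ᵇ-true q<θ | ∨-zeroʳ (pat21 q w ∨ has321 w) = refl

-- The entries of Q can only be placed in order, from position i on, and then none of
-- them is a fixed point.
Behind : ℕ → List ℕ → Set
Behind i []      = ⊤
Behind i (q ∷ Q) = q < i × Behind (suc i) Q

Behind-suc : ∀ i Q → Behind i Q → Behind (suc i) Q
Behind-suc i []      _       = tt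
Behind-suc i (q ∷ Q) (l , b) = m≤n⇒m≤1+n l , Behind-suc (suc i) Q b

Behind-∷ʳ : ∀ i Q a → a < i + length Q → Behind i Q → Behind i (Q ∷ʳ a)
Behind-∷ʳ i []      a l _       = subst (a <_) (ℕₚ.+-identityʳ i) l , tt
Behind-∷ʳ i (q ∷ Q) a l (k , b) = k , Behind-∷ʳ (suc i) Q a (subst (a <_) (+-suc i (length Q)) l) b

length-∷ʳ : ∀ (X : List ℕ) a → length (X ∷ʳ a) ≡ suc (length X)
length-∷ʳ X a = trans (length-++ X) (ℕₚ.+-comm (length X) 1)

AllPairs-∷ʳ : ∀ {X a} → AllPairs _<_ X → All (_< a) X → AllPairs _<_ (X ∷ʳ a)
AllPairs-∷ʳ s l = AllPairsₚ.++⁺ s ([] ∷ []) (All.map (_∷ []) l)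

-- A letter below the maximum that is not the smallest unused one completes a 321.
pick-late : ∀ r x X Q s θ M i → suc (length X) + (length Q + s) ≡ suc r →
  AllPairs _<_ (x ∷ Q) → All (_< θ) Q →
  pick r (x ∷ X) (Q ++ up M s) (weight θ i) ≈ pick r (x ∷ X ++ Q) (up M s) (weight θ i)
pick-late r x X []      s θ M i l _ _ rewrite ++-identityʳ X = ≈-refl
pick-late r x X (q ∷ Q) s θ M i l ((x<q ∷ x<Q) ∷ (_ ∷ Q↗)) (q<θ ∷ Q<θ) = begin
  sumArr r (x ∷ X ++ R) (weight θ i ∘ (q ∷_)) ⊕ pick r (x ∷ X ∷ʳ q) R (weight θ i)
    ≈⟨ +-cong (≈-trans (sumArr-cong r (x ∷ X ++ R) len late) (sumArr-zero r (x ∷ X ++ R)))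
              (pick-late r x (X ∷ʳ q) Q s θ M i len′ (x<Q ∷ Q↗) Q<θ) ⟩
  0# ⊕ pick r (x ∷ (X ∷ʳ q) ++ Q) (up M s) (weight θ i)
    ≈⟨ +-identityˡ _ ⟩
  pick r (x ∷ (X ∷ʳ q) ++ Q) (up M s) (weight θ i)
    ≡⟨ cong (λ A → pick r (x ∷ A) (up M s) (weight θ i)) (∷ʳ-++ X q Q) ⟩
  pick r (x ∷ X ++ q ∷ Q) (up M s) (weight θ i) ∎
  where
  R = Q ++ up M s

  len : length (x ∷ X ++ R) ≡ r
  len = trans (cong suc (trans (length-++ X) (cong (length X +_) (trans (length-++ Q) (cong (length Q +_) (length-up M s))))))
          (suc-injective (trans (cong suc (sym (+-suc (length X) (length Q + s)))) l))

  len′ : suc (length (X ∷ʳ q)) + (length Q + s) ≡ suc r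
  len′ = trans (cong (λ n → suc n + (length Q + s)) (length-∷ʳ X q))
               (trans (cong suc (sym (+-suc (length X) (length Q + s)))) l)

  late : ∀ w → (∀ p → countB p w ≡ countB p (x ∷ X ++ R)) → weight θ i (q ∷ w) ≈ 0#
  late w c = reflexive (weight-late w q<θ
    (trans (c (_<ᵇ q)) (cong (λ b → (if b then 1 else 0) + countB (_<ᵇ q) (X ++ R)) (<ᵇ-true x<q))))

sumArr≈W : ∀ r Q s θ M i → length Q + s ≡ r → AllPairs _<_ Q → All (_< θ) Q → θ ≤ M →
  i + length Q ≡ M → Behind i Q →
  sumArr r (Q ++ up M s) (weight θ i) ≈ W (length Q) r
pick≈recordSteps : ∀ r X s θ a i → length X + s ≡ suc r → AllPairs _<_ X → All (_< a) X → θ ≤ a →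
  i + length X ≡ a → Behind (suc i) X →
  pick r X (up a s) (weight θ i) ≈ recordSteps (λ j → W j r) (length X) s

sumArr≈W zero [] zero θ M i _ _ _ _ _ _ = mono-monomial 0 0 0
sumArr≈W (suc r) [] .(suc r) θ M i refl Q↗ Q<θ θ≤M e b = ≈-trans
  (pick≈recordSteps r [] (suc r) θ M i refl [] [] θ≤M e tt)
  (≈-sym (+-identityˡ _))
sumArr≈W (suc r) (q ∷ Q) s θ M i l (q<Q ∷ Q↗) (q<θ ∷ Q<θ) θ≤M e (q<i , b) = +-cong
  (≈-trans (sumArr-cong r (Q ++ up M s) len first)
           (sumArr≈W r Q s θ M (suc i) l′ Q↗ Q<θ θ≤M (trans (sym (+-suc i (length Q))) e) b))
  -- Taking any other entry of Q contributes 0, so only records are left.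
  (≈-trans (pick-late r q [] Q s θ M i l (q<Q ∷ Q↗) Q<θ)
    (≈-trans (pick≈recordSteps r (q ∷ Q) s θ M i l (q<Q ∷ Q↗) (All.map (λ p → <-≤-trans p θ≤M) (q<θ ∷ Q<θ)) θ≤M e
               (Behind-suc i (q ∷ Q) (q<i , b)))
      (reflexive (cong (recordSteps (λ j → W j r) (suc (length Q))) s≡))))
  where
  l′ : length Q + s ≡ r
  l′ = suc-injective l
  s≡ : s ≡ r ∸ length Q
  s≡ = trans (sym (ℕₚ.m+n∸m≡n (length Q) s)) (cong (_∸ length Q) l′)
  len : length (Q ++ up M s) ≡ r
  len = trans (length-++ Q) (trans (cong (length Q +_) (length-up M s)) l′)
  first : ∀ w → (∀ p → countB p w ≡ countB p (Q ++ up M s)) → weight θ i (q ∷ w) ≈ weight θ (suc i) w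
  first w c = reflexive (weight-nonrecord w q<θ q<i (trans (c (_<ᵇ q))
    (countB-above (Allₚ.++⁺ (All.map <⇒≤ q<Q) (All.map (≤-trans (<⇒≤ (<-≤-trans q<θ θ≤M))) (up-≥ M s))))))

pick≈recordSteps r X zero    θ a i l X↗ X<a θ≤a e b = ≈-refl
pick≈recordSteps r X (suc s) θ a i l X↗ X<a θ≤a e b = +-cong
  (begin
    sumArr r A (weight θ i ∘ (a ∷_))
      ≈⟨ sumArr-cong r A len (λ w c → weight-record i k w θ≤a e (trans (c (_<ᵇ a)) below)) ⟩
    sumArr r A (λ w → recordWeight k ⊛ weight a (suc i) w)
      ≈⟨ sumArr-scale r A (recordWeight k) (weight a (suc i)) ⟩
    recordWeight k ⊛ sumArr r A (weight a (suc i))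
      ≈⟨ *-congˡ (sumArr≈W r X s a (suc a) (suc i) l′ X↗ X<a (ℕₚ.n≤1+n a) (cong suc e) b) ⟩
    recordWeight k ⊛ W k r ∎)
  (≈-trans
    (pick≈recordSteps r (X ∷ʳ a) s θ (suc a) i (trans (cong (_+ s) (length-∷ʳ X a)) (cong suc l′))
      (AllPairs-∷ʳ X↗ X<a) (Allₚ.∷ʳ⁺ (All.map m≤n⇒m≤1+n X<a) ≤-refl) (m≤n⇒m≤1+n θ≤a)
      (trans (cong (i +_) (length-∷ʳ X a)) (trans (+-suc i k) (cong suc e)))
      (Behind-∷ʳ (suc i) X a (≤-reflexive (cong suc (sym e))) b))
    (reflexive (cong (λ n → recordSteps (λ j → W j r) n s) (length-∷ʳ X a))))
  where
  k = length X
  A = X ++ up (suc a) s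
  l′ : k + s ≡ r
  l′ = suc-injective (trans (sym (+-suc k s)) l)
  len : length A ≡ r
  len = trans (length-++ X) (trans (cong (k +_) (length-up (suc a) s)) l′)
  below : countB (_<ᵇ a) A ≡ k
  below = trans (countB-++ (_<ᵇ a) X (up (suc a) s))
    (trans (cong₂ _+_ (countB-below X<a) (countB-above (All.map <⇒≤ (up-≥ (suc a) s)))) (ℕₚ.+-identityʳ k))

-- Left-to-right maxima and the list of permutations.

nth : ℕ → List ℕ → ℕ
nth i       []      = 0
nth zero    (a ∷ v) = a
nth (suc i) (a ∷ v) = nth i v

-- The local functions of lrm and perms have no name outside Defs.  They are obtained as
-- solutions of the metavariables below: the with-abstractions replace the surrounding
-- functions and repeated arguments by variables, which brings the unification problems
-- into the pattern fragment.
mutual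
  isRecord : List ℕ → ℕ → Bool
  isRecord = _

  lrmLength : List ℕ → ℕ
  lrmLength = _

  lrm-unfold : ∀ w → lrm w ≡ countB (isRecord w) (range (lrmLength w))
  lrm-unfold w with countB {ℕ} | range
  ... | _ | _ = refl

mutual
  lrmLen : List ℕ → List ℕ → ℕ
  lrmLen = _

  lrmNth : List ℕ → ℕ → List ℕ → ℕ
  lrmNth = _

  lrmLength-∷ : ∀ a v → lrmLength (a ∷ v) ≡ suc (length v)
  lrmLength-∷ a v with a ∷ v
  ... | w = cong suc (lrmLen≡length w v)

  isRecord-suc : ∀ a v i → isRecord (a ∷ v) (suc i) ≡ (nth i v ≡ᵇ (a ⊔ maxList (take (suc i) v)))
  isRecord-suc a v i with a ∷ v | _≡ᵇ_
  ... | w | _==_ = cong (λ k → k == (a ⊔ maxList (take (suc i) v))) (lrmNth≡nth w i v)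

  lrmLen≡length : ∀ w v → lrmLen w v ≡ length v
  lrmLen≡length w []      = refl
  lrmLen≡length w (a ∷ v) = cong suc (lrmLen≡length w v)

  lrmNth≡nth : ∀ w i v → lrmNth w i v ≡ nth i v
  lrmNth≡nth w zero    []      = refl
  lrmNth≡nth w (suc i) []      = refl
  lrmNth≡nth w zero    (a ∷ v) = refl
  lrmNth≡nth w (suc i) (a ∷ v) = lrmNth≡nth w i v

countB-cong : ∀ {p r : ℕ → Bool} → p ≗ r → countB p ≗ countB r
countB-cong e []      = refl
countB-cong e (a ∷ w) = cong₂ (λ b n → (if b then 1 else 0) + n) (e a) (countB-cong e w)

countB-map : ∀ (p : ℕ → Bool) (f : ℕ → ℕ) l → countB p (map f l) ≡ countB (p ∘ f) l
countB-map p f []      = refl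
countB-map p f (a ∷ l) = cong ((if p (f a) then 1 else 0) +_) (countB-map p f l)

-- θ is the maximum of the letters already read; regrouping the prefix maximum makes `θ ⊔ b` the new
-- θ after a letter b.
records-count : ∀ θ v →
  countB (λ i → nth i v ≡ᵇ (θ ⊔ maxList (take (suc i) v))) (range (length v)) ≡ records θ v
records-count θ []      = refl
records-count θ (b ∷ v) = trans
  (cong ((if b ≡ᵇ θ ⊔ (b ⊔ 0) then 1 else 0) +_) (trans
    (countB-map (λ i → nth i (b ∷ v) ≡ᵇ (θ ⊔ maxList (take (suc i) (b ∷ v)))) suc (range (length v)))
    (trans (countB-cong (λ i → cong (nth i v ≡ᵇ_) (sym (ℕₚ.⊔-assoc θ b _))) (range (length v)))
           (records-count (θ ⊔ b) v))))
  step
  where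
  step : (if b ≡ᵇ θ ⊔ (b ⊔ 0) then 1 else 0) + records (θ ⊔ b) v ≡ records θ (b ∷ v)
  step rewrite ℕₚ.⊔-identityʳ b with θ ≤? b
  ... | yes θ≤b rewrite ℕₚ.m≤n⇒m⊔n≡n θ≤b | ≡ᵇ-true b | ≤⇒≤ᵇ-true θ≤b = refl
  ... | no  θ≰b rewrite ℕₚ.m≥n⇒m⊔n≡m (ℕₚ.≰⇒≥ θ≰b) | ≡ᵇ-false (<⇒≢ (ℕₚ.≰⇒> θ≰b)) | >⇒≤ᵇ-false (ℕₚ.≰⇒> θ≰b) = refl

lrm≡records : ∀ w → lrm w ≡ records 0 w
lrm≡records []      = refl
lrm≡records (a ∷ v) = trans (lrm-unfold (a ∷ v))
  (trans (cong (countB (isRecord (a ∷ v)) ∘ range) (lrmLength-∷ a v))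
    (cong₂ (λ b n → (if b then 1 else 0) + n) first
      (trans (countB-map (isRecord (a ∷ v)) suc (range (length v)))
        (trans (countB-cong (isRecord-suc a v) (range (length v))) (records-count a v)))))
  where
  first : (a ≡ᵇ a ⊔ 0) ≡ true
  first = trans (cong (a ≡ᵇ_) (ℕₚ.⊔-identityʳ a)) (≡ᵇ-true a)

keepDistinct : List (List ℕ) → List (List ℕ)
keepDistinct []       = []
keepDistinct (w ∷ ws) = if distinct w then w ∷ keepDistinct ws else keepDistinct ws

mutual
  permsGo : ℕ → List (List ℕ) → List (List ℕ)
  permsGo = _

  perms≡keepDistinct : ∀ n → perms n ≡ keepDistinct (words n n)
  perms≡keepDistinct n with words n n
  ... | ws = permsGo≡keepDistinct n ws

  permsGo≡keepDistinct : ∀ n ws → permsGo n ws ≡ keepDistinct ws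
  permsGo≡keepDistinct n []       = refl
  permsGo≡keepDistinct n (w ∷ ws) with distinct w
  ... | true  = cong (w ∷_) (permsGo≡keepDistinct n ws)
  ... | false = permsGo≡keepDistinct n ws

-- From permutations to path weights.

sumL-keepDistinct : ∀ f ws → sumL f (keepDistinct ws) ≈ sumL (ifDistinct f) ws
sumL-keepDistinct f []       = ≈-refl
sumL-keepDistinct f (w ∷ ws) with distinct w
... | true  = +-congˡ (sumL-keepDistinct f ws)
... | false = ≈-trans (sumL-keepDistinct f ws) (≈-sym (+-identityˡ _))

range≡up : ∀ n → range n ≡ up 0 n
range≡up zero    = refl
range≡up (suc n) = cong (0 ∷_) (trans (cong (map suc) (range≡up n)) (map-suc-up 0 n))
  where
  map-suc-up : ∀ M s → map suc (up M s) ≡ up (suc M) s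
  map-suc-up M zero    = refl
  map-suc-up M (suc s) = cong (suc M ∷_) (map-suc-up (suc M) s)

up-unique : ∀ M s → Unique (up M s)
up-unique M zero    = []
up-unique M (suc s) = All.map <⇒≢ (up-≥ (suc M) s) ∷ up-unique (suc M) s

pat21-zero : ∀ w → pat21 0 w ≡ false
pat21-zero []      = refl
pat21-zero (a ∷ w) = pat21-zero w

weight-coefficient : ∀ w a b c → weight 0 0 w a b c ≡
  (if not (has321 w) ∧ (inv w ≡ᵇ a) ∧ (lrm w ≡ᵇ b) ∧ (fix w ≡ᵇ c) then 1 else 0)
weight-coefficient w a b c rewrite pat21-zero w | lrm≡records w | ∨-identityʳ (has321 w) with has321 w
... | true  = refl
... | false = refl

countB≡sumL : ∀ a b c ws →
  countB (λ w → not (has321 w) ∧ (inv w ≡ᵇ a) ∧ (lrm w ≡ᵇ b) ∧ (fix w ≡ᵇ c)) ws ≡ sumL (weight 0 0) ws a b c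
countB≡sumL a b c []       = refl
countB≡sumL a b c (w ∷ ws) = cong₂ _+_ (sym (weight-coefficient w a b c)) (countB≡sumL a b c ws)

Icoef≈W : ∀ n → Icoef n ≈ W 0 n
Icoef≈W n = ≈-trans (λ a b c → countB≡sumL a b c (perms n)) (begin
  sumL (weight 0 0) (perms n)
    ≡⟨ cong (sumL (weight 0 0)) (perms≡keepDistinct n) ⟩
  sumL (weight 0 0) (keepDistinct (words n n))
    ≈⟨ sumL-keepDistinct (weight 0 0) (words n n) ⟩
  sumL (ifDistinct (weight 0 0)) (words n n)
    ≈⟨ sumL-words n n _ ⟩
  sumWords n (range n) (ifDistinct (weight 0 0))
    ≡⟨ cong (λ A → sumWords n A (ifDistinct (weight 0 0))) (range≡up n) ⟩
  sumWords n (up 0 n) (ifDistinct (weight 0 0))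
    ≈⟨ sumWords-distinct n (up 0 n) (weight 0 0) (up-unique 0 n) ⟩
  sumArr n (up 0 n) (weight 0 0)
    -- Initially θ = 0; as `records` compares non-strictly, the letter 0 in first place still counts
    -- as a record.
    ≈⟨ sumArr≈W n [] n 0 0 0 refl [] [] z≤n refl tt ⟩
  W 0 n ∎)

theorem8p3 : (n : ℕ) → ∃[ N ] ((m : ℕ) → N ≤ m →
    (a b c : ℕ) → JF m n a b c ≡ 𝔍 n a b c)
-- Every truncation of depth above n already has the limiting coefficient of z^n.
theorem8p3 n = suc n , λ m n<m → ≈-trans (JF≈W n m n<m) (≈-sym (Icoef≈W n))
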